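{- For all integers $k\ge 1$ and $m\ge 0$, we have $w_{2k-1,k,m}=\binom{2k-1}{k-1}N_{k-1,m}$.
   Context: A Dyck path of semilength $n$ is a word in the letters $U,D$ with $n$ copies of each letter such that no prefix contains more $D$'s than $U$'s. A $UD$-factor (resp. $UUD$-factor) is an occurrence of $UD$ (resp. $UUD$) as a consecutive subword. $w_{n,k,m}$ denotes the number of Dyck paths of semilength $n$ with exactly $k$ $UD$-factors and exactly $m$ $UUD$-factors. The Narayana numbers are $N_{n,j}=\frac{1}{n}\binom{n}{j}\binom{n}{j-1}$ for $n\ge1$, $j\ge0$ (so $N_{n,j}=0$ unless $1\le j\le n$), and $N_{0,0}=1$, $N_{0,j}=0$ for $j\ge 1$. -}

module Defs where

open import Data.Nat using (ℕ; zero; suc; _+_; _*_; _∸_; _/_; _≤ᵇ_)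
open import Data.Nat.Combinatorics using (_C_)
open import Data.Bool using (Bool; true; false; _∧_; if_then_else_)
open import Data.List using (List; []; _∷_; length; filterᵇ; map; concatMap; _++_)
open import Relation.Nullary.Decidable using (⌊_⌋)
open import Data.Nat using (_≟_)

data Step : Set where
  U D : Step

words : ℕ → List (List Step)
words zero = [] ∷ []
words (suc ℓ) = map (U ∷_) (words ℓ) ++ map (D ∷_) (words ℓ)

count : Step → List Step → ℕ
count s [] = 0
count U (U ∷ w) = suc (count U w)
count D (D ∷ w) = suc (count D w)
count U (D ∷ w) = count U w
count D (U ∷ w) = count D w

prefixOK : ℕ → List Step → Bool
prefixOK h [] = true
prefixOK h (U ∷ w) = prefixOK (suc h) w
prefixOK zero (D ∷ w) = false
prefixOK (suc h) (D ∷ w) = prefixOK h w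

isDyck : ℕ → List Step → Bool
isDyck n w = ⌊ count U w ≟ n ⌋ ∧ ⌊ count D w ≟ n ⌋ ∧ prefixOK 0 w

udFactors : List Step → ℕ
udFactors [] = 0
udFactors (U ∷ D ∷ w) = suc (udFactors (D ∷ w))
udFactors (_ ∷ w) = udFactors w

uudFactors : List Step → ℕ
uudFactors [] = 0
uudFactors (U ∷ U ∷ D ∷ w) = suc (uudFactors (U ∷ D ∷ w))
uudFactors (_ ∷ w) = uudFactors w

w : ℕ → ℕ → ℕ → ℕ
w n k m = length (filterᵇ (λ p → isDyck n p ∧ ⌊ udFactors p ≟ k ⌋ ∧ ⌊ uudFactors p ≟ m ⌋)
                        (words (n + n)))

-- Narayana numbers: N_{0,0} = 1, N_{0,j} = 0 (j ≥ 1);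
-- N_{n,j} = (1/n) C(n,j) C(n,j-1) for n ≥ 1 (with C(n,-1) = 0, so N_{n,0} = 0).
-- The division is exact; _/_ is natural-number division.
N : ℕ → ℕ → ℕ
N zero zero = 1
N zero (suc j) = 0
N (suc n) zero = 0
N (suc n) (suc j) = ((suc n C suc j) * (suc n C j)) / suc n

{-# OPTIONS --safe #-}

-- Read a word from left to right and remember how many U's (none, one, at least two) end the part
-- already read.  From a position where the last letter is not U, with d D's and u = k + s U's left,
-- the number of completions with k UD-factors and m UUD-factors is
--   C(d,k) C(k,m) c(s,m) − C(d,k−1) C(k−1,m−1) C(s,m),
-- where c(s,m) is the number of compositions of s into m positive parts; the other two phases have
-- similar 2×2 determinants.  Every step inside the region is then Pascal's rule, and the step that
-- would cross the axis (u = d + 1) is harmless because there the determinant vanishes.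
module Submission where

open import Defs
open import Data.Bool using (Bool; true; false; _∧_)
open import Data.Bool.Properties using (∧-zeroʳ)
open import Data.List using (List; []; _∷_; length; filterᵇ; map; _++_)
open import Data.Nat using (ℕ; zero; suc; _+_; _*_; _∸_; _/_; _≤_; _<_; _≟_; _≡ᵇ_; z≤n; s≤s; s≤s⁻¹)
open import Data.Nat.Combinatorics using (_C_; nCk≡nC[n∸k]; nCn≡1; nC1≡n; k>n⇒nCk≡0; nCk+nC[k+1]≡[n+1]C[k+1])
open import Data.Nat.Divisibility using (divides)
open import Data.Nat.DivMod using (/-congˡ; m*n/n≡m; +-distrib-/-∣ʳ)
open import Data.Nat.Properties
open import Data.Nat.Tactic.RingSolver using (solve-∀)
open import Function using (_∘_)
open import Relation.Binary.PropositionalEquality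
  using (_≡_; refl; sym; trans; cong; cong₂; subst; module ≡-Reasoning)
open import Relation.Nullary.Decidable using (⌊_⌋; isYes≗does)

open ≡-Reasoning

private variable
  A B : Set

-- Binomial identities and the two determinants.

infixl 6.5 _C⁻_

-- C(n, k − 1), with the convention C(n, −1) = 0.
_C⁻_ : ℕ → ℕ → ℕ
n C⁻ zero  = 0
n C⁻ suc k = n C k

-- For s ≥ 1, a composition is a choice of m - 1 of the s - 1 gaps between s units.
compositions : ℕ → ℕ → ℕ
compositions zero    zero    = 1
compositions zero    (suc m) = 0
compositions (suc s) m       = s C⁻ m

nC0≡1 : ∀ n → n C 0 ≡ 1
nC0≡1 n = trans (nCk≡nC[n∸k] {0} {n} z≤n) (nCn≡1 n)

pascal : ∀ n k → suc n C k ≡ (n C⁻ k) + (n C k)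
pascal n zero    = trans (nC0≡1 (suc n)) (sym (nC0≡1 n))
pascal n (suc k) = sym (nCk+nC[k+1]≡[n+1]C[k+1] n k)

absorption : ∀ n k → suc k * (suc n C suc k) ≡ suc n * (n C k)
absorption n       zero    = begin
  1 * (suc n C 1)    ≡⟨ *-identityˡ (suc n C 1) ⟩
  suc n C 1          ≡⟨ nC1≡n (suc n) ⟩
  suc n              ≡⟨ *-identityʳ (suc n) ⟨
  suc n * 1          ≡⟨ cong (suc n *_) (nC0≡1 n) ⟨
  suc n * (n C 0)    ∎
absorption zero    (suc k) = *-zeroʳ (2 + k)
absorption (suc n) (suc k) = begin
  (2 + k) * ((2 + n) C (2 + k))                 ≡⟨ cong ((2 + k) *_) (pascal (suc n) (2 + k)) ⟩
  (2 + k) * (x + y)                             ≡⟨ regroup k x y ⟩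
  x + (suc k * x + (2 + k) * y)                 ≡⟨ cong (x +_) (cong₂ _+_ (absorption n k) (absorption n (suc k))) ⟩
  x + (suc n * (n C k) + suc n * (n C suc k))   ≡⟨ cong (x +_) (*-distribˡ-+ (suc n) (n C k) _) ⟨
  x + suc n * ((n C k) + (n C suc k))               ≡⟨ cong (λ z → x + suc n * z) (pascal n (suc k)) ⟨
  (2 + n) * x                                   ∎
  where
  x = suc n C suc k
  y = suc n C (2 + k)
  regroup : ∀ k x y → (2 + k) * (x + y) ≡ x + (suc k * x + (2 + k) * y)
  regroup = solve-∀

-- After adding `suc k * (n C k)` to both sides, Pascal's rule reduces this to `absorption`. Writing
-- n as `k + suc s` avoids the subtraction n - k.
absorption-+ : ∀ k s → suc k * ((k + suc s) C suc k) ≡ suc s * ((k + suc s) C k)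
absorption-+ k s = +-cancelˡ-≡ (suc k * x) _ _ (begin
  suc k * x + suc k * (n C suc k)  ≡⟨ *-distribˡ-+ (suc k) x _ ⟨
  suc k * (x + (n C suc k))        ≡⟨ cong (suc k *_) (pascal n (suc k)) ⟨
  suc k * (suc n C suc k)          ≡⟨ absorption n k ⟩
  suc (k + suc s) * x              ≡⟨ *-distribʳ-+ x (suc k) (suc s) ⟩
  suc k * x + suc s * x            ∎)
  where
  n = k + suc s
  x = n C k

-- This makes the forbidden step below the axis contribute 0. For positive m and s, multiply by m:
-- the factor passes from one binomial to the next by three absorptions and turns one product into
-- the other. Otherwise both sides are 0.
determinant-vanishes : ∀ k m s →
  ((k + s) C k) * (k C⁻ m) * (s C m) ≡ ((k + s) C suc k) * (suc k C m) * compositions s m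
determinant-vanishes k zero zero = begin
  ((k + 0) C k) * 0 * 1                  ≡⟨ cong (_* 1) (*-zeroʳ ((k + 0) C k)) ⟩
  0                                      ≡⟨ vanish ⟨
  ((k + 0) C suc k) * (suc k C 0) * 1    ∎
  where
  vanish : ((k + 0) C suc k) * (suc k C 0) * 1 ≡ 0
  -- Here `compositions 0 0` is 1, so the zero has to come from `k C suc k`.
  vanish rewrite +-identityʳ k = cong (λ x → x * (suc k C 0) * 1) (k>n⇒nCk≡0 (n<1+n k))
determinant-vanishes k zero (suc s) = begin
  a * 0 * (suc s C 0)  ≡⟨ cong (_* (suc s C 0)) (*-zeroʳ a) ⟩
  0                    ≡⟨ *-zeroʳ b ⟨
  b * 0                ∎
  where
  a = (k + suc s) C k
  b = ((k + suc s) C suc k) * (suc k C 0)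
determinant-vanishes k (suc m) zero =
  trans (*-zeroʳ (((k + 0) C k) * (k C m))) (sym (*-zeroʳ (((k + 0) C suc k) * (suc k C suc m))))
determinant-vanishes k (suc m) (suc s) = *-cancelˡ-≡ _ _ (suc m) (begin
  suc m * (a * b * c)                   ≡⟨ regroup₁ (suc m) a b c ⟩
  a * b * (suc m * c)                   ≡⟨ cong (a * b *_) (absorption s m) ⟩
  a * b * (suc s * (s C m))             ≡⟨ regroup₂ (suc s) a b (s C m) ⟩
  suc s * a * b * (s C m)               ≡⟨ cong (λ x → x * b * (s C m)) (absorption-+ k s) ⟨
  suc k * a′ * b * (s C m)              ≡⟨ regroup₃ (suc k) a′ b (s C m) ⟩
  a′ * (suc k * b) * (s C m)            ≡⟨ cong (λ x → a′ * x * (s C m)) (absorption k m) ⟨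
  a′ * (suc m * b′) * (s C m)           ≡⟨ regroup₄ (suc m) a′ b′ (s C m) ⟩
  suc m * (a′ * b′ * (s C m))           ∎)
  where
  a  = (k + suc s) C k
  b  = k C m
  c  = suc s C suc m
  a′ = (k + suc s) C suc k
  b′ = suc k C suc m
  regroup₁ : ∀ i x y z → i * (x * y * z) ≡ x * y * (i * z)
  regroup₁ = solve-∀
  regroup₂ : ∀ i x y z → x * y * (i * z) ≡ i * x * y * z
  regroup₂ = solve-∀
  regroup₃ : ∀ i x y z → i * x * y * z ≡ x * (i * y) * z
  regroup₃ = solve-∀
  regroup₄ : ∀ i x y z → x * (i * y) * z ≡ i * (x * y * z)
  regroup₄ = solve-∀

-- The Narayana number is itself a 2×2 determinant of binomials; this is the form in which it comes
-- out of the path count.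
narayana-determinant : ∀ n m →
  N n m + (n C⁻ m) * (n C m) ≡ (suc n C m) * compositions n m
narayana-determinant zero    zero    = refl
narayana-determinant zero    (suc m) = trans (*-zeroʳ (0 C m)) (sym (*-zeroʳ (1 C suc m)))
narayana-determinant (suc n) zero    = sym (*-zeroʳ (suc (suc n) C 0))
narayana-determinant (suc n) (suc m) = begin
  -- Scaling the second term by `suc n` puts everything under one quotient, whose numerator turns
  -- out to be a multiple of `suc n`; so the floor division is exact.
  (a * b) / suc n + b * a                        ≡⟨ cong ((a * b) / suc n +_) (m*n/n≡m (b * a) (suc n)) ⟨
  (a * b) / suc n + (b * a * suc n) / suc n      ≡⟨ +-distrib-/-∣ʳ (a * b) (divides (b * a) refl) ⟨
  (a * b + b * a * suc n) / suc n                ≡⟨ /-congˡ clear-denominator ⟩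
  (e * (n C m) * suc n) / suc n                  ≡⟨ m*n/n≡m (e * (n C m)) (suc n) ⟩
  e * (n C m)                                    ∎
  where
  a = suc n C suc m
  b = suc n C m
  e = suc (suc n) C suc m
  regroup₁ : ∀ n a b → a * b + b * a * suc n ≡ a * (suc (suc n) * b)
  regroup₁ = solve-∀
  regroup₂ : ∀ i a e → a * (i * e) ≡ e * (i * a)
  regroup₂ = solve-∀
  regroup₃ : ∀ i e c → e * (i * c) ≡ e * c * i
  regroup₃ = solve-∀
  clear-denominator : a * b + b * a * suc n ≡ e * (n C m) * suc n
  clear-denominator = begin
    a * b + b * a * suc n      ≡⟨ regroup₁ n a b ⟩
    a * (suc (suc n) * b)      ≡⟨ cong (a *_) (absorption (suc n) m) ⟨
    a * (suc m * e)            ≡⟨ regroup₂ (suc m) a e ⟩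
    e * (suc m * a)            ≡⟨ cong (e *_) (absorption n m) ⟩
    e * (suc n * (n C m))      ≡⟨ regroup₃ (suc n) e (n C m) ⟩
    e * (n C m) * suc n        ∎

-- Recursive count of completions by phase.

-- The number of U's at the end of the part of the word already read.
data Phase : Set where
  none one many : Phase

afterU : Phase → Phase
afterU none = one
afterU one  = many
afterU many = many

-- paths p h u k m counts the completions from height h with u further U's (and h + u further D's)
-- that contribute k UD-factors and m UUD-factors.
mutual
  paths : Phase → (h u k m : ℕ) → ℕ
  paths p zero    zero    zero    zero    = 1
  paths p zero    zero    zero    (suc m) = 0
  paths p zero    zero    (suc k) m       = 0
  paths p zero    (suc u) k       m       = pathsU p 0 (suc u) k m
  paths p (suc h) u       k       m       = pathsU p (suc h) u k m + pathsD p h u k m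

  pathsU : Phase → (h u k m : ℕ) → ℕ
  pathsU p h zero    k m = 0
  pathsU p h (suc u) k m = paths (afterU p) (suc h) u k m

  pathsD : Phase → (h u k m : ℕ) → ℕ
  pathsD none h u k       m       = paths none h u k m
  pathsD one  h u zero    m       = 0
  pathsD one  h u (suc k) m       = paths none h u k m
  pathsD many h u zero    m       = 0
  pathsD many h u (suc k) zero    = 0
  pathsD many h u (suc k) (suc m) = paths none h u k m

-- From filtered words to the recursive count.

-- A canonical remainder of the part already read. It has no `D`, so every factor found after
-- prepending it is completed by a letter still to come; two `U`s suffice for `UUD`.
prefix : Phase → List Step
prefix none = []
prefix one  = U ∷ []
prefix many = U ∷ U ∷ []

-- The tests use `≡ᵇ` because it cancels successors by computation, so reading a letter often
-- becomes definitional.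
completes : Phase → (h u d k m : ℕ) → List Step → Bool
completes p h u d k m x =
  ((count U x ≡ᵇ u) ∧ (count D x ≡ᵇ d) ∧ prefixOK h x) ∧
  (udFactors (prefix p ++ x) ≡ᵇ k) ∧ (uudFactors (prefix p ++ x) ≡ᵇ m)

countᵇ : (A → Bool) → List A → ℕ
countᵇ f xs = length (filterᵇ f xs)

countᵇ-cong : {f g : A → Bool} → (∀ x → f x ≡ g x) → ∀ xs → countᵇ f xs ≡ countᵇ g xs
countᵇ-cong f≗g [] = refl
countᵇ-cong {f = f} {g} f≗g (x ∷ xs) with f x | g x | f≗g x
... | true  | true  | _ = cong suc (countᵇ-cong f≗g xs)
... | false | false | _ = countᵇ-cong f≗g xs

countᵇ-false : (xs : List A) → countᵇ (λ _ → false) xs ≡ 0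
countᵇ-false []       = refl
countᵇ-false (x ∷ xs) = countᵇ-false xs

countᵇ-none : {f : A → Bool} → (∀ x → f x ≡ false) → ∀ xs → countᵇ f xs ≡ 0
countᵇ-none f≗false xs = trans (countᵇ-cong f≗false xs) (countᵇ-false xs)

countᵇ-++ : (f : A → Bool) → ∀ xs ys → countᵇ f (xs ++ ys) ≡ countᵇ f xs + countᵇ f ys
countᵇ-++ f []       ys = refl
countᵇ-++ f (x ∷ xs) ys with f x
... | true  = cong suc (countᵇ-++ f xs ys)
... | false = countᵇ-++ f xs ys

countᵇ-map : (f : B → Bool) (g : A → B) → ∀ xs → countᵇ f (map g xs) ≡ countᵇ (f ∘ g) xs
countᵇ-map f g []       = refl
countᵇ-map f g (x ∷ xs) with f (g x)
... | true  = cong suc (countᵇ-map f g xs)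
... | false = countᵇ-map f g xs

countᵇ-words-suc : (f : List Step → Bool) → ∀ n →
  countᵇ f (words (suc n)) ≡ countᵇ (f ∘ (U ∷_)) (words n) + countᵇ (f ∘ (D ∷_)) (words n)
countᵇ-words-suc f n = trans (countᵇ-++ f (map (U ∷_) (words n)) _)
  (cong₂ _+_ (countᵇ-map f (U ∷_) (words n)) (countᵇ-map f (D ∷_) (words n)))

completes-U : ∀ p h u d k m x →
  completes p h (suc u) d k m (U ∷ x) ≡ completes (afterU p) (suc h) u d k m x
completes-U none h u d k m x = refl
completes-U one  h u d k m x = refl
completes-U many h u d k m x = refl

mutual
  -- Splitting words by their first letter reproduces the recursion of `paths`. The numbers d and n
  -- are tied by equations so that the call after a `U` can exchange `h + suc u` for `suc h + u`.
  countᵇ-completes : ∀ p h u {d n} k m → d ≡ h + u → n ≡ u + d →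
    countᵇ (completes p h u d k m) (words n) ≡ paths p h u k m
  countᵇ-completes none zero zero zero    zero    refl refl = refl
  countᵇ-completes none zero zero zero    (suc m) refl refl = refl
  countᵇ-completes none zero zero (suc k) m       refl refl = refl
  countᵇ-completes one  zero zero zero    zero    refl refl = refl
  countᵇ-completes one  zero zero zero    (suc m) refl refl = refl
  countᵇ-completes one  zero zero (suc k) m       refl refl = refl
  countᵇ-completes many zero zero zero    zero    refl refl = refl
  countᵇ-completes many zero zero zero    (suc m) refl refl = refl
  countᵇ-completes many zero zero (suc k) m       refl refl = refl
  countᵇ-completes p zero (suc u) {d} k m refl refl = begin
    countᵇ (completes p 0 (suc u) d k m) (words (suc (u + suc u)))
      ≡⟨ countᵇ-words-suc (completes p 0 (suc u) d k m) (u + suc u) ⟩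
    _ ≡⟨ cong₂ _+_ (countᵇ-completes-U p 0 (suc u) k m refl refl)
                   (countᵇ-none below-axis (words (u + suc u))) ⟩
    pathsU p 0 (suc u) k m + 0
      ≡⟨ +-identityʳ _ ⟩
    pathsU p 0 (suc u) k m ∎
    where
    below-axis : ∀ x → completes p 0 (suc u) d k m (D ∷ x) ≡ false
    below-axis x rewrite ∧-zeroʳ (count D (D ∷ x) ≡ᵇ d) | ∧-zeroʳ (count U x ≡ᵇ suc u) = refl
  countᵇ-completes p (suc h) u {d} k m refl refl rewrite +-suc u (h + u) =
    trans (countᵇ-words-suc (completes p (suc h) u d k m) (u + (h + u)))
      (cong₂ _+_ (countᵇ-completes-U p (suc h) u k m refl (sym (+-suc u (h + u))))
                 (countᵇ-completes-D p h u k m refl refl))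

  countᵇ-completes-U : ∀ p h u {d n} k m → d ≡ h + u → suc n ≡ u + d →
    countᵇ (completes p h u d k m ∘ (U ∷_)) (words n) ≡ pathsU p h u k m
  countᵇ-completes-U p h zero    {n = n} k m d≡ n≡ = countᵇ-none (λ _ → refl) (words n)
  countᵇ-completes-U p h (suc u) {d} {n} k m d≡ n≡ =
    trans (countᵇ-cong (completes-U p h u d k m) (words n))
      (countᵇ-completes (afterU p) (suc h) u k m (trans d≡ (+-suc h u)) (suc-injective n≡))

  countᵇ-completes-D : ∀ p h u {d n} k m → d ≡ h + u → n ≡ u + d →
    countᵇ (completes p (suc h) u (suc d) k m ∘ (D ∷_)) (words n) ≡ pathsD p h u k m
  countᵇ-completes-D none h u k       m       d≡ n≡ = countᵇ-completes none h u k m d≡ n≡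
  -- The `D` closes a UD-factor, so the comparison with 0 already computes to `false`.
  countᵇ-completes-D one  h u {n = n} zero m  d≡ n≡ = countᵇ-none (λ _ → ∧-zeroʳ _) (words n)
  countᵇ-completes-D one  h u (suc k) m       d≡ n≡ = countᵇ-completes none h u k m d≡ n≡
  countᵇ-completes-D many h u {n = n} zero m  d≡ n≡ = countᵇ-none (λ _ → ∧-zeroʳ _) (words n)
  countᵇ-completes-D many h u {d} {n} (suc k) zero d≡ n≡ = countᵇ-none no-uud (words n)
    where
    no-uud : ∀ x → completes many (suc h) u (suc d) (suc k) 0 (D ∷ x) ≡ false
    no-uud x rewrite ∧-zeroʳ (udFactors x ≡ᵇ k) = ∧-zeroʳ _
  countᵇ-completes-D many h u (suc k) (suc m) d≡ n≡ = countᵇ-completes none h u k m d≡ n≡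

completes-start : ∀ n k m x →
  isDyck n x ∧ ⌊ udFactors x ≟ k ⌋ ∧ ⌊ uudFactors x ≟ m ⌋ ≡ completes none 0 n n k m x
completes-start n k m x = cong₂ _∧_
  (cong₂ _∧_ (isYes≗does (count U x ≟ n)) (cong (_∧ prefixOK 0 x) (isYes≗does (count D x ≟ n))))
  (cong₂ _∧_ (isYes≗does (udFactors x ≟ k)) (isYes≗does (uudFactors x ≟ m)))

w≡paths : ∀ n k m → w n k m ≡ paths none 0 n k m
w≡paths n k m =
  trans (countᵇ-cong (completes-start n k m) (words (n + n))) (countᵇ-completes none 0 n k m refl refl)

-- Boundary values of the recursive count.

-- At positive height a `D` must still come, and the first one closes a UD-factor with the run of
-- `U`s before it.
paths-afterU-noUD : ∀ p h u m → paths (afterU p) (suc h) u 0 m ≡ 0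
paths-afterU-noUD none h zero    m = refl
paths-afterU-noUD one  h zero    m = refl
paths-afterU-noUD many h zero    m = refl
paths-afterU-noUD none h (suc u) m = trans (+-identityʳ _) (paths-afterU-noUD one (suc h) u m)
paths-afterU-noUD one  h (suc u) m = trans (+-identityʳ _) (paths-afterU-noUD many (suc h) u m)
paths-afterU-noUD many h (suc u) m = trans (+-identityʳ _) (paths-afterU-noUD many (suc h) u m)

-- The same argument: the first `D` ends a run of at least two `U`s.
paths-many-noUUD : ∀ h u k → paths many (suc h) u k 0 ≡ 0
paths-many-noUUD h zero    zero    = refl
paths-many-noUUD h zero    (suc k) = refl
paths-many-noUUD h (suc u) zero    = trans (+-identityʳ _) (paths-many-noUUD (suc h) u zero)
paths-many-noUUD h (suc u) (suc k) = trans (+-identityʳ _) (paths-many-noUUD (suc h) u (suc k))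

pendingUD : Phase → ℕ
pendingUD none = 0
pendingUD one  = 1
pendingUD many = 1

pendingUD≤1 : ∀ p → pendingUD p ≤ 1
pendingUD≤1 none = z≤n
pendingUD≤1 one  = ≤-refl
pendingUD≤1 many = ≤-refl

mutual
  -- Each UD-factor has its own `U`, either an unread one or the one just read.
  paths-fewU : ∀ p h u k m → pendingUD p + u < k → paths p h u k m ≡ 0
  paths-fewU p zero    zero    (suc k) m lt = refl
  paths-fewU p zero    (suc u) k       m lt = pathsU-fewU p 0 (suc u) k m
    (≤-<-trans (m≤n+m (suc u) (pendingUD p)) lt)
  paths-fewU p (suc h) u       k       m lt =
    cong₂ _+_ (pathsU-fewU p (suc h) u k m (≤-<-trans (m≤n+m u (pendingUD p)) lt))
              (pathsD-fewU p h u k m lt)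

  -- The bound loses `pendingUD p`: a `U` followed by another `U` starts no UD-factor.
  pathsU-fewU : ∀ p h u k m → u < k → pathsU p h u k m ≡ 0
  pathsU-fewU p h zero    k m lt = refl
  pathsU-fewU p h (suc u) k m lt = paths-fewU (afterU p) (suc h) u k m
    (≤-<-trans (+-monoˡ-≤ u (pendingUD≤1 (afterU p))) lt)

  pathsD-fewU : ∀ p h u k m → pendingUD p + u < k → pathsD p h u k m ≡ 0
  pathsD-fewU none h u k       m       lt = paths-fewU none h u k m lt
  pathsD-fewU one  h u (suc k) m       lt = paths-fewU none h u k m (s≤s⁻¹ lt)
  pathsD-fewU many h u (suc k) zero    lt = refl
  pathsD-fewU many h u (suc k) (suc m) lt = paths-fewU none h u k m (s≤s⁻¹ lt)

-- Only the word consisting of `D`s alone remains, so the value is 1 exactly for u = m = 0.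
paths-none-noUD : ∀ h u m → paths none h u 0 m ≡ (0 C m) * compositions u m
paths-none-noUD zero    zero    zero    = refl
paths-none-noUD zero    zero    (suc m) = refl
paths-none-noUD zero    (suc u) zero    = paths-afterU-noUD none 0 u 0
paths-none-noUD zero    (suc u) (suc m) = paths-afterU-noUD none 0 u (suc m)
paths-none-noUD (suc h) zero    m       = paths-none-noUD h zero m
paths-none-noUD (suc h) (suc u) m       =
  cong₂ _+_ (paths-afterU-noUD none (suc h) u m) (paths-none-noUD h (suc u) m)

-- Adding and splitting determinants.

-- A formula "count = minuend - subtrahend" is kept as a sum. The formulas for the `U` step and the
-- `D` step add up once Pascal's rule has split both products.
add-differences : ∀ x y p p′ {P Q q q′} → P ≡ p + p′ → Q ≡ q + q′ →
  x + p ≡ q → y + p′ ≡ q′ → x + y + P ≡ Q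
add-differences x y p p′ refl refl refl refl = regroup x y p p′
  where
  regroup : ∀ x y p p′ → x + y + (p + p′) ≡ x + p + (y + p′)
  regroup = solve-∀

distrib-left : ∀ y z a b {x} → x ≡ y + z → x * a * b ≡ y * a * b + z * a * b
distrib-left y z a b refl = regroup y z a b
  where
  regroup : ∀ y z a b → (y + z) * a * b ≡ y * a * b + z * a * b
  regroup = solve-∀

distrib-middle : ∀ y z a b {x} → x ≡ y + z → a * x * b ≡ a * y * b + a * z * b
distrib-middle y z a b refl = regroup y z a b
  where
  regroup : ∀ y z a b → a * (y + z) * b ≡ a * y * b + a * z * b
  regroup = solve-∀

pascal-pred : ∀ n k m → (n C⁻ k) * (k C m) ≡ (n C⁻ k) * ((k ∸ 1) C⁻ m + (k ∸ 1) C m)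
pascal-pred n zero    m = refl
pascal-pred n (suc k) m = cong ((n C⁻ suc k) *_) (pascal k m)

0Cm≡compositions : ∀ m → 0 C m ≡ compositions 0 m
0Cm≡compositions zero    = refl
0Cm≡compositions (suc m) = refl

sCm≡compositions+compositions : ∀ s m → suc s C m ≡ (s C m) + compositions (suc s) m
sCm≡compositions+compositions s m = trans (pascal s m) (+-comm (s C⁻ m) (s C m))

1C[1+m]≡0Cm : ∀ m → 1 C suc m ≡ 0 C m
1C[1+m]≡0Cm m = trans (pascal 0 (suc m)) (+-identityʳ (0 C m))

u<1+k : ∀ {u k} → u ≡ k + 0 → u < suc k
u<1+k {k = k} eq = s≤s (≤-reflexive (trans eq (+-identityʳ k)))

pred-sum : ∀ {u k s} → suc u ≡ k + suc s → u ≡ k + s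
pred-sum {k = k} {s} eq = suc-injective (trans eq (+-suc k s))

-- The determinant formulas in the three phases.

-- The U of the next UD-factor is already read in the phases one and many, so there u = k + s goes
-- with k + 1 UD-factors.  For k = 0 the truncated k ∸ 1 is harmless, as it is multiplied by _ C⁻ 0 = 0.
mutual
  paths-none : ∀ h u k m s → u ≡ k + s →
    paths none h u k m + ((h + u) C⁻ k) * ((k ∸ 1) C⁻ m) * (s C m)
      ≡ ((h + u) C k) * (k C m) * compositions s m
  paths-none h u zero m s refl = begin
    paths none h u 0 m + 0                      ≡⟨ +-identityʳ _ ⟩
    paths none h u 0 m                          ≡⟨ paths-none-noUD h u m ⟩
    (0 C m) * compositions u m                  ≡⟨ cong (_* compositions u m) (*-identityˡ (0 C m)) ⟨
    1 * (0 C m) * compositions u m              ≡⟨ cong (λ x → x * (0 C m) * compositions u m) (nC0≡1 (h + u)) ⟨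
    ((h + u) C 0) * (0 C m) * compositions u m  ∎
  -- On the axis only `U` is possible. The missing `D` term is supplied as a vanishing determinant,
  -- so that Pascal's rule in the number of `D`s applies as in the interior.
  paths-none zero (suc u) (suc k) m s refl = begin
    x + (suc u C k) * (k C⁻ m) * (s C m)
      ≡⟨ cong (x +_) (distrib-left (u C⁻ k) (u C k) (k C⁻ m) (s C m) (pascal u k)) ⟩
    x + ((u C⁻ k) * (k C⁻ m) * (s C m) + (u C k) * (k C⁻ m) * (s C m))
      ≡⟨ +-assoc x _ _ ⟨
    x + (u C⁻ k) * (k C⁻ m) * (s C m) + (u C k) * (k C⁻ m) * (s C m)
      ≡⟨ cong₂ _+_ (paths-one 0 u k m s refl) (determinant-vanishes k m s) ⟩
    (u C k) * (suc k C m) * compositions s m + (u C suc k) * (suc k C m) * compositions s m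
      ≡⟨ distrib-left (u C k) (u C suc k) (suc k C m) (compositions s m) (pascal u (suc k)) ⟨
    (suc u C suc k) * (suc k C m) * compositions s m ∎
    where
    x = paths one 1 u (suc k) m
  -- Pascal's rule acts on the first binomial of each product.
  paths-none (suc h) (suc u) (suc k) m s eq = add-differences
    (paths one (suc (suc h)) u (suc k) m) (paths none h (suc u) (suc k) m)
    ((n C⁻ k) * (k C⁻ m) * (s C m)) ((n C k) * (k C⁻ m) * (s C m))
    (distrib-left (n C⁻ k) (n C k) (k C⁻ m) (s C m) (pascal n k))
    (distrib-left (n C k) (n C suc k) (suc k C m) (compositions s m) (pascal n (suc k)))
    (subst (λ d → paths one (suc (suc h)) u (suc k) m + (d C⁻ k) * (k C⁻ m) * (s C m)
                    ≡ (d C k) * (suc k C m) * compositions s m)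
      (sym (+-suc h u)) (paths-one (suc h) u k m s (suc-injective eq)))
    (paths-none h (suc u) (suc k) m s eq)
    where
    n = h + suc u

  paths-one : ∀ h u k m s → u ≡ k + s →
    paths one (suc h) u (suc k) m + ((h + u) C⁻ k) * (k C⁻ m) * (s C m)
      ≡ ((h + u) C k) * (suc k C m) * compositions s m
  -- With s = 0 all k + 1 UD-factors need distinct `U`s, including the one just read; hence the next
  -- letter is `D`.
  paths-one h u k zero zero eq = begin
    pathsU one (suc h) u (suc k) 0 + y + P * 0 * 1
      ≡⟨ cong (λ x → x + y + P * 0 * 1) (pathsU-fewU one (suc h) u (suc k) 0 (u<1+k eq)) ⟩
    y + P * 0 * 1                        ≡⟨ paths-none h u k 0 0 eq ⟩
    ((h + u) C k) * (k C 0) * 1          ≡⟨ cong (λ x → ((h + u) C k) * x * 1) (trans (nC0≡1 k) (sym (nC0≡1 (suc k)))) ⟩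
    ((h + u) C k) * (suc k C 0) * 1      ∎
    where
    P = (h + u) C⁻ k
    y = paths none h u k 0
  paths-one h u k (suc m) zero eq = begin
    pathsU one (suc h) u (suc k) (suc m) + y + P * (k C m) * 0
      ≡⟨ cong₂ (λ x z → x + y + z) (pathsU-fewU one (suc h) u (suc k) (suc m) (u<1+k eq))
           (trans (*-zeroʳ (P * (k C m))) (sym (*-zeroʳ (P * ((k ∸ 1) C m))))) ⟩
    y + P * ((k ∸ 1) C m) * 0                   ≡⟨ paths-none h u k (suc m) 0 eq ⟩
    ((h + u) C k) * (k C suc m) * 0             ≡⟨ *-zeroʳ (((h + u) C k) * (k C suc m)) ⟩
    0                                           ≡⟨ *-zeroʳ (((h + u) C k) * (suc k C suc m)) ⟨
    ((h + u) C k) * (suc k C suc m) * 0         ∎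
    where
    P = (h + u) C⁻ k
    y = paths none h u k (suc m)
  paths-one h zero    k m    (suc s) eq with () ← trans eq (+-suc k s)
  paths-one h (suc u) k zero (suc s) eq = begin
    paths many (suc (suc h)) u (suc k) 0 + y + P * 0 * (suc s C 0)
      ≡⟨ cong (λ x → x + y + P * 0 * (suc s C 0)) (paths-many-noUUD (suc h) u (suc k)) ⟩
    y + P * 0 * (suc s C 0)               ≡⟨ paths-none h (suc u) k 0 (suc s) eq ⟩
    ((h + suc u) C k) * (k C 0) * 0       ≡⟨ *-zeroʳ (((h + suc u) C k) * (k C 0)) ⟩
    0                                     ≡⟨ *-zeroʳ (((h + suc u) C k) * (suc k C 0)) ⟨
    ((h + suc u) C k) * (suc k C 0) * 0   ∎
    where
    P = (h + suc u) C⁻ k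
    y = paths none h (suc u) k 0
  -- Now Pascal's rule acts on the middle binomial: a `U` prepares a UUD-factor, while a `D` gives
  -- it up.
  paths-one h (suc u) k (suc m) (suc s) eq = add-differences
    (paths many (suc (suc h)) u (suc k) (suc m)) (paths none h (suc u) k (suc m))
    ((n C⁻ k) * ((k ∸ 1) C⁻ m) * (suc s C suc m)) ((n C⁻ k) * ((k ∸ 1) C m) * (suc s C suc m))
    (trans (cong (_* (suc s C suc m)) (pascal-pred n k m))
           (distrib-middle ((k ∸ 1) C⁻ m) ((k ∸ 1) C m) (n C⁻ k) (suc s C suc m) refl))
    (distrib-middle (k C m) (k C suc m) (n C k) (s C m) (pascal k (suc m)))
    (subst (λ d → paths many (suc (suc h)) u (suc k) (suc m)
                    + (d C⁻ k) * ((k ∸ 1) C⁻ m) * (suc s C suc m)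
                    ≡ (d C k) * (k C m) * (s C m))
      (sym (+-suc h u)) (paths-many (suc h) u k m s (pred-sum eq)))
    (paths-none h (suc u) k (suc m) (suc s) eq)
    where
    n = h + suc u

  paths-many : ∀ h u k m s → u ≡ k + s →
    paths many (suc h) u (suc k) (suc m) + ((h + u) C⁻ k) * ((k ∸ 1) C⁻ m) * (suc s C suc m)
      ≡ ((h + u) C k) * (k C m) * (s C m)
  paths-many h u k m zero eq = begin
    pathsU many (suc h) u (suc k) (suc m) + y + P * (1 C suc m)
      ≡⟨ cong₂ (λ x z → x + y + P * z) (pathsU-fewU many (suc h) u (suc k) (suc m) (u<1+k eq))
           (1C[1+m]≡0Cm m) ⟩
    y + P * (0 C m)                                ≡⟨ paths-none h u k m 0 eq ⟩
    ((h + u) C k) * (k C m) * compositions 0 m     ≡⟨ cong (((h + u) C k) * (k C m) *_) (0Cm≡compositions m) ⟨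
    ((h + u) C k) * (k C m) * (0 C m)              ∎
    where
    P = ((h + u) C⁻ k) * ((k ∸ 1) C⁻ m)
    y = paths none h u k m
  paths-many h zero    k m (suc s) eq with () ← trans eq (+-suc k s)
  -- Now it acts on the last binomial: a further `U` uses up one unit of the excess s.
  paths-many h (suc u) k m (suc s) eq = add-differences
    (paths many (suc (suc h)) u (suc k) (suc m)) (paths none h (suc u) k m)
    (P * (suc s C suc m)) (P * (suc s C m))
    (trans (cong (P *_) (trans (pascal (suc s) (suc m)) (+-comm (suc s C m) (suc s C suc m))))
           (*-distribˡ-+ P (suc s C suc m) (suc s C m)))
    (trans (cong (Q *_) (sCm≡compositions+compositions s m)) (*-distribˡ-+ Q (s C m) (s C⁻ m)))
    (subst (λ d → paths many (suc (suc h)) u (suc k) (suc m)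
                    + (d C⁻ k) * ((k ∸ 1) C⁻ m) * (suc s C suc m)
                    ≡ (d C k) * (k C m) * (s C m))
      (sym (+-suc h u)) (paths-many (suc h) u k m s (pred-sum eq)))
    (paths-none h (suc u) k m (suc s) eq)
    where
    P = ((h + suc u) C⁻ k) * ((k ∸ 1) C⁻ m)
    Q = ((h + suc u) C k) * (k C m)

theorem4p7 : (k m : ℕ) → 1 ≤ k →
    w (2 * k ∸ 1) k m ≡ ((2 * k ∸ 1) C (k ∸ 1)) * N (k ∸ 1) m
theorem4p7 (suc k) m _ = begin
  w n (suc k) m             ≡⟨ w≡paths n (suc k) m ⟩
  paths none 0 n (suc k) m  ≡⟨ +-cancelʳ-≡ (b * (k C⁻ m) * (k C m)) _ _ determinant ⟩
  b * N k m                 ∎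
  where
  n = 2 * suc k ∸ 1
  b = n C k
  n≡ : n ≡ suc k + k
  n≡ = trans (cong (k +_) (cong suc (+-identityʳ k))) (+-suc k k)
  -- Since n = 2k + 1 with the shifted k, the two central binomials agree and factor out of both
  -- products. The excess s is k, so what remains is `narayana-determinant`.
  symmetric : n C suc k ≡ b
  symmetric = trans (nCk≡nC[n∸k] (subst (suc k ≤_) (sym n≡) (m≤m+n (suc k) k)))
    (cong (n C_) (trans (cong (_∸ suc k) n≡) (m+n∸m≡n (suc k) k)))
  determinant : paths none 0 n (suc k) m + b * (k C⁻ m) * (k C m)
    ≡ b * N k m + b * (k C⁻ m) * (k C m)
  determinant = begin
    paths none 0 n (suc k) m + b * (k C⁻ m) * (k C m)  ≡⟨ paths-none 0 n (suc k) m k n≡ ⟩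
    (n C suc k) * (suc k C m) * compositions k m       ≡⟨ cong (λ x → x * (suc k C m) * compositions k m) symmetric ⟩
    b * (suc k C m) * compositions k m                 ≡⟨ *-assoc b (suc k C m) _ ⟩
    b * ((suc k C m) * compositions k m)               ≡⟨ cong (b *_) (narayana-determinant k m) ⟨
    b * (N k m + (k C⁻ m) * (k C m))                   ≡⟨ *-distribˡ-+ b (N k m) _ ⟩
    b * N k m + b * ((k C⁻ m) * (k C m))               ≡⟨ cong (b * N k m +_) (*-assoc b (k C⁻ m) _) ⟨
    b * N k m + b * (k C⁻ m) * (k C m)                 ∎
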